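{- Let $p<q<r$ be pairwise coprime prime powers (each $>1$). Then $$H(\Psi^*_{pqr})\le\Big\lfloor\frac{(p-1)(q-1)}{r}\Big\rfloor+1\le p-1.$$
   Context: A divisor $d$ of $n$ is unitary, $d\,\|\,n$, if $\gcd(d,n/d)=1$; $\mu^*(n)=(-1)^{\omega(n)}$ with $\omega(n)$ the number of distinct prime factors of $n$; $\Phi^*_n(x)=\prod_{d\,\|\,n}(x^d-1)^{\mu^*(n/d)}$ is the unitary cyclotomic polynomial and $\Psi^*_n(x)=(x^n-1)/\Phi^*_n(x)$ is the inverse unitary cyclotomic polynomial (an integer polynomial). For a polynomial $f$, $H(f)$ is the maximum absolute value of its coefficients. -}

module Defs where

open import Data.Nat using (ℕ; zero; suc; _⊔_; _∸_; _^_; NonZero)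
open import Data.Nat.Divisibility using (_∣_; _∣?_)
open import Data.Nat.DivMod using (_/_)
open import Data.Nat.GCD using (gcd)
open import Data.Nat.Primality using (Prime; prime?)
open import Data.Nat.Coprimality using (Coprime)
open import Data.Integer as ℤ using (ℤ; +_; -[1+_]; ∣_∣)
open import Data.List using (List; []; _∷_; [_]; _++_; replicate; map; filter; length; upTo; foldr)
open import Data.Product using (Σ; _×_)
open import Relation.Nullary using (Dec)
open import Relation.Nullary.Decidable using (_×-dec_)
open import Relation.Binary.PropositionalEquality using (_≡_)
import Data.Nat as ℕ

-- Integer polynomials as coefficient lists (constant term first).

Poly : Set
Poly = List ℤ

coeff : Poly → ℕ → ℤ
coeff []      _       = + 0
coeff (a ∷ f) zero    = a
coeff (a ∷ f) (suc k) = coeff f k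

-- equality of polynomials: all coefficients agree (ignores trailing zeros)
_≈P_ : Poly → Poly → Set
f ≈P g = (k : ℕ) → coeff f k ≡ coeff g k

_+P_ : Poly → Poly → Poly
[]      +P g       = g
(a ∷ f) +P []      = a ∷ f
(a ∷ f) +P (b ∷ g) = (a ℤ.+ b) ∷ (f +P g)

_*P_ : Poly → Poly → Poly
[]      *P g = []
(a ∷ f) *P g = map (a ℤ.*_) g +P (+ 0 ∷ (f *P g))

oneP : Poly
oneP = [ + 1 ]

prodP : List Poly → Poly
prodP = foldr _*P_ oneP

xPow : ℕ → Poly
xPow d = replicate d (+ 0) ++ [ + 1 ]

xPowMinus1 : ℕ → Poly
xPowMinus1 d = xPow d +P [ -[1+ 0 ] ]

H : Poly → ℕ
H = foldr (λ a m → ∣ a ∣ ⊔ m) 0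

-- d+1 is a unitary divisor of n: (d+1) ∣ n and gcd(d+1, n/(d+1)) = 1
-- (indexing by d+1 since 0 is never a divisor of n ≥ 1)
IsUnitaryDivisor : ℕ → ℕ → Set
IsUnitaryDivisor d n = (suc d ∣ n) × (gcd (suc d) (n / suc d) ≡ 1)

isUnitaryDivisor? : (n d : ℕ) → Dec (IsUnitaryDivisor d n)
isUnitaryDivisor? n d = (suc d ∣? n) ×-dec (gcd (suc d) (n / suc d) ℕ.≟ 1)


ω : ℕ → ℕ
ω n = length (filter (λ p → prime? p ×-dec (p ∣? n)) (upTo (suc n)))

-- μ*(m) = (-1)^ω(m); we record whether it is +1
μ*Positive? : (m : ℕ) → Dec (ℕ._%_ (ω m) 2 ≡ 0)
μ*Positive? m = ℕ._%_ (ω m) 2 ℕ.≟ 0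

μ*Negative? : (m : ℕ) → Dec (ℕ._%_ (ω m) 2 ≡ 1)
μ*Negative? m = ℕ._%_ (ω m) 2 ℕ.≟ 1

-- Φ*_n = ∏_{d ∥ n} (x^d - 1)^{μ*(n/d)} = ΦNum n / ΦDen n, where the
-- unitary divisors d ∈ {1,…,n} are enumerated as suc d' for d' ∈ upTo n.
ΦNum : (n : ℕ) → .{{NonZero n}} → Poly
ΦNum n = prodP (map (λ d → xPowMinus1 (suc d))
           (filter (λ d → μ*Positive? (n / suc d)) (filter (isUnitaryDivisor? n) (upTo n))))

ΦDen : (n : ℕ) → .{{NonZero n}} → Poly
ΦDen n = prodP (map (λ d → xPowMinus1 (suc d))
           (filter (λ d → μ*Negative? (n / suc d)) (filter (isUnitaryDivisor? n) (upTo n))))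

-- f is the inverse unitary cyclotomic polynomial Ψ*_n = (x^n - 1) / Φ*_n,
-- i.e.  f · ΦNum n = (x^n - 1) · ΦDen n  (determines f uniquely in ℤ[x]).
IsΨ* : (n : ℕ) → .{{NonZero n}} → Poly → Set
IsΨ* n f = (f *P ΦNum n) ≈P (xPowMinus1 n *P ΦDen n)

IsPrimePower : ℕ → Set
IsPrimePower m = Σ ℕ λ ℓ → Σ ℕ λ k → Prime ℓ × (m ≡ ℓ ^ suc k)

{-# OPTIONS --safe #-}

-- Unfolding the definition, Ψ*_{pqr} = Φ · B(x^r), where Φ is the unitary cyclotomic polynomial of pq, with
-- (x^p - 1)(x^q - 1) Φ = (x^{pq} - 1)(x - 1), and B(y) = (y^p - 1)(y^q - 1)/(y - 1).
-- Φ and B have all coefficients in {-1, 0, 1}, and Φ has degree at most (p - 1)(q - 1), so at most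
-- (p - 1)(q - 1)/r + 1 of the copies x^{jr} Φ contribute to any given coefficient of the product.

module Submission where

-- Sorted by the parity of the number of primes in n/d, the eight unitary divisors d of n = pqr give
-- p, q, r, n in the numerator of the unitary cyclotomic polynomial of n and 1, pq, pr, qr in its
-- denominator. In the inverse polynomial the factor x^n - 1 cancels and the other seven regroup:
-- those for 1, pq, p, q form Φ, and those for pr, qr, r form B(x^r). Prime powers enter through
-- this list of divisors; the analysis of Φ rests on the coprimality of p and q. No polynomial is
-- ever divided by another. Each quotient is written down explicitly and checked by multiplying
-- back, which leaves identities for a ring solver. The copies of Φ are added by the triangle
-- inequality, with no cancellation between them. The second inequality holds because q - 1 < r
-- makes (p - 1)(q - 1)/r smaller than p - 1.

open import Defs
open import Algebra.Bundles using (CommutativeMonoid; CommutativeRing)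
open import Algebra.Solver.Ring.AlmostCommutativeRing
  using (AlmostCommutativeRing; fromCommutativeRing; _-Raw-AlmostCommutative⟶_)
import Algebra.Solver.Ring as RingSolver
open import Data.Bool using (Bool; true; false; not)
open import Data.Nat using (ℕ; zero; suc; _<_; _≤_; _∸_; _*_; _+_; _^_; NonZero; z≤n; s≤s)
import Data.Nat as ℕ
import Data.Nat.Properties as ℕP
open import Data.Nat.DivMod
open import Data.Nat.Divisibility
open import Data.Nat.Coprimality as Coprimality
  using (Coprime; coprime-Bézout; coprime-divisor; 1-coprimeTo; coprime⇒gcd≡1; gcd≡1⇒coprime)
open import Data.Nat.GCD using (module Bézout)
open import Data.Nat.Induction using (<-rec)
open import Data.Nat.Primality
open import Data.Nat.Tactic.RingSolver using (solve-∀)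
open import Data.Integer as ℤ using (ℤ; +_; -[1+_]; ∣_∣)
  renaming (-_ to neg; _+_ to _+ᶻ_; _*_ to _*ᶻ_)
import Data.Integer.Properties as ℤP
import Data.Integer.Tactic.RingSolver as ℤSolver
open import Data.List
  using (List; []; _∷_; [_]; _++_; replicate; map; foldr; applyUpTo; upTo; concatMap; filter)
open import Data.List.Properties using (map-applyUpTo; map-∘)
open import Data.List.Membership.Propositional using (_∈_)
open import Data.List.Membership.Propositional.Properties
  using (∈-applyUpTo⁺; ∈-applyUpTo⁻; ∈-upTo⁺; ∈-upTo⁻; ∈-map⁺; ∈-map⁻; ∈-filter⁺; ∈-filter⁻)
open import Data.List.Membership.Propositional.Properties.WithK using (unique∧set⇒bag)
open import Data.List.Relation.Binary.BagAndSetEquality using (∼bag⇒↭)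
open import Data.List.Relation.Binary.Permutation.Propositional as ↭ using (_↭_)
open import Data.List.Relation.Binary.Permutation.Propositional.Properties using (↭-length)
open import Data.List.Relation.Unary.All as All using (All; []; _∷_)
import Data.List.Relation.Unary.All.Properties as All
open import Data.List.Relation.Unary.AllPairs as AllPairs using ([]; _∷_)
open import Data.List.Relation.Unary.Any using (here; there)
open import Data.List.Relation.Unary.Linked using (Linked; [-]; _∷_)
open import Data.List.Relation.Unary.Linked.Properties using (Linked⇒AllPairs)
open import Data.List.Relation.Unary.Unique.Propositional using (Unique)
import Data.List.Relation.Unary.Unique.Propositional.Properties as Unique
open import Data.Maybe using (Maybe)
open import Data.Product using (Σ; ∃; _×_; _,_; proj₂)
open import Data.Sum using (inj₁; inj₂; [_,_]′)
open import Function using (_∘_; it; mk⇔)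
open import Level using (0ℓ)
open import Relation.Nullary using (¬_; yes; no; contradiction)
open import Relation.Nullary.Decidable using (map′; _×-dec_)
open import Relation.Nullary.Decidable.Core using (dec⇒maybe)
open import Relation.Unary using (Pred; Decidable)
open import Relation.Binary.PropositionalEquality hiding ([_])

-- The ring of integer polynomials

-- ≈P unfolds to a Π-type, from which the two polynomials cannot be inferred; from the record they can.
infix 4 _≋_
record _≋_ (f g : Poly) : Set where
  constructor pointwise
  field coeffs : f ≈P g

open _≋_

negP : Poly → Poly
negP = map neg

coeff-+P : ∀ f g k → coeff (f +P g) k ≡ coeff f k +ᶻ coeff g k
coeff-+P []      g       k       = sym (ℤP.+-identityˡ (coeff g k))
coeff-+P (a ∷ f) []      k       = sym (ℤP.+-identityʳ (coeff (a ∷ f) k))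
coeff-+P (a ∷ f) (b ∷ g) zero    = refl
coeff-+P (a ∷ f) (b ∷ g) (suc k) = coeff-+P f g k

coeff-scale : ∀ a f k → coeff (map (a *ᶻ_) f) k ≡ a *ᶻ coeff f k
coeff-scale a []      k       = sym (ℤP.*-zeroʳ a)
coeff-scale a (b ∷ f) zero    = refl
coeff-scale a (b ∷ f) (suc k) = coeff-scale a f k

coeff-neg : ∀ f k → coeff (negP f) k ≡ ℤ.- coeff f k
coeff-neg []      k       = refl
coeff-neg (b ∷ f) zero    = refl
coeff-neg (b ∷ f) (suc k) = coeff-neg f k

coeff-∷*P : ∀ a f g k → coeff ((a ∷ f) *P g) k ≡ a *ᶻ coeff g k +ᶻ coeff (+ 0 ∷ (f *P g)) k
coeff-∷*P a f g k = trans (coeff-+P (map (a *ᶻ_) g) _ k) (cong (_+ᶻ _) (coeff-scale a g k))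

coeff-cong-∷ : ∀ {f g} → f ≈P g → (+ 0 ∷ f) ≈P (+ 0 ∷ g)
coeff-cong-∷ p zero    = refl
coeff-cong-∷ p (suc k) = p k

*P-congˡ : ∀ f {g h} → g ≈P h → (f *P g) ≈P (f *P h)
*P-congˡ []      p k = refl
*P-congˡ (a ∷ f) {g} {h} p k = begin
  coeff ((a ∷ f) *P g) k                          ≡⟨ coeff-∷*P a f g k ⟩
  a *ᶻ coeff g k +ᶻ coeff (+ 0 ∷ (f *P g)) k    ≡⟨ cong₂ _+ᶻ_ (cong (a *ᶻ_) (p k)) (coeff-cong-∷ (*P-congˡ f p) k) ⟩
  a *ᶻ coeff h k +ᶻ coeff (+ 0 ∷ (f *P h)) k    ≡⟨ coeff-∷*P a f h k ⟨
  coeff ((a ∷ f) *P h) k                          ∎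
  where open ≡-Reasoning

*P-zeroʳ : ∀ f → (f *P []) ≈P []
*P-zeroʳ []      k       = refl
*P-zeroʳ (a ∷ f) zero    = refl
*P-zeroʳ (a ∷ f) (suc k) = *P-zeroʳ f k

-- `_*P_` recurses on its left factor; this is the mirror recursion on the right factor, which the
-- induction for commutativity needs.
coeff-*P∷ : ∀ f b g k → coeff (f *P (b ∷ g)) k ≡ b *ᶻ coeff f k +ᶻ coeff (+ 0 ∷ (f *P g)) k
coeff-*P∷ [] b g zero    = sym (trans (ℤP.+-identityʳ _) (ℤP.*-zeroʳ b))
coeff-*P∷ [] b g (suc k) = sym (trans (ℤP.+-identityʳ _) (ℤP.*-zeroʳ b))
coeff-*P∷ (a ∷ f) b g zero = cong (_+ᶻ + 0) (ℤP.*-comm a b)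
coeff-*P∷ (a ∷ f) b g (suc k) = begin
  coeff (map (a *ᶻ_) g +P (f *P (b ∷ g))) k
    ≡⟨ coeff-+P (map (a *ᶻ_) g) _ k ⟩
  coeff (map (a *ᶻ_) g) k +ᶻ coeff (f *P (b ∷ g)) k
    ≡⟨ cong₂ _+ᶻ_ (coeff-scale a g k) (coeff-*P∷ f b g k) ⟩
  a *ᶻ coeff g k +ᶻ (b *ᶻ coeff f k +ᶻ coeff (+ 0 ∷ (f *P g)) k)
    ≡⟨ swap-summands (a *ᶻ coeff g k) (b *ᶻ coeff f k) _ ⟩
  b *ᶻ coeff f k +ᶻ (a *ᶻ coeff g k +ᶻ coeff (+ 0 ∷ (f *P g)) k)
    ≡⟨ cong ((b *ᶻ coeff f k) +ᶻ_) (coeff-∷*P a f g k) ⟨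
  b *ᶻ coeff f k +ᶻ coeff ((a ∷ f) *P g) k ∎
  where
  open ≡-Reasoning
  swap-summands : ∀ x y z → x +ᶻ (y +ᶻ z) ≡ y +ᶻ (x +ᶻ z)
  swap-summands = ℤSolver.solve-∀

*P-comm : ∀ f g → (f *P g) ≈P (g *P f)
*P-comm []      g k = sym (*P-zeroʳ g k)
*P-comm (a ∷ f) g k = begin
  coeff ((a ∷ f) *P g) k                        ≡⟨ coeff-∷*P a f g k ⟩
  a *ᶻ coeff g k +ᶻ coeff (+ 0 ∷ (f *P g)) k  ≡⟨ cong ((a *ᶻ coeff g k) +ᶻ_) (coeff-cong-∷ (*P-comm f g) k) ⟩
  a *ᶻ coeff g k +ᶻ coeff (+ 0 ∷ (g *P f)) k  ≡⟨ coeff-*P∷ g a f k ⟨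
  coeff (g *P (a ∷ f)) k                        ∎
  where open ≡-Reasoning

*P-distribʳ : ∀ h f g → ((f +P g) *P h) ≈P ((f *P h) +P (g *P h))
*P-distribʳ h []      g  k = refl
*P-distribʳ h (a ∷ f) [] k = sym (trans (coeff-+P ((a ∷ f) *P h) [] k) (ℤP.+-identityʳ _))
*P-distribʳ h (a ∷ f) (b ∷ g) k = begin
  coeff (((a +ᶻ b) ∷ (f +P g)) *P h) k
    ≡⟨ coeff-∷*P (a +ᶻ b) (f +P g) h k ⟩
  (a +ᶻ b) *ᶻ coeff h k +ᶻ coeff (+ 0 ∷ ((f +P g) *P h)) k
    ≡⟨ cong (((a +ᶻ b) *ᶻ coeff h k) +ᶻ_) (trans (coeff-cong-∷ (*P-distribʳ h f g) k) (coeff-+P (+ 0 ∷ (f *P h)) (+ 0 ∷ (g *P h)) k)) ⟩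
  (a +ᶻ b) *ᶻ coeff h k +ᶻ (coeff (+ 0 ∷ (f *P h)) k +ᶻ coeff (+ 0 ∷ (g *P h)) k)
    ≡⟨ regroup a b (coeff h k) _ _ ⟩
  (a *ᶻ coeff h k +ᶻ coeff (+ 0 ∷ (f *P h)) k) +ᶻ (b *ᶻ coeff h k +ᶻ coeff (+ 0 ∷ (g *P h)) k)
    ≡⟨ cong₂ _+ᶻ_ (coeff-∷*P a f h k) (coeff-∷*P b g h k) ⟨
  coeff ((a ∷ f) *P h) k +ᶻ coeff ((b ∷ g) *P h) k
    ≡⟨ coeff-+P ((a ∷ f) *P h) ((b ∷ g) *P h) k ⟨
  coeff (((a ∷ f) *P h) +P ((b ∷ g) *P h)) k ∎
  where
  open ≡-Reasoning
  regroup : ∀ x y z u v → (x +ᶻ y) *ᶻ z +ᶻ (u +ᶻ v) ≡ (x *ᶻ z +ᶻ u) +ᶻ (y *ᶻ z +ᶻ v)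
  regroup = ℤSolver.solve-∀

coeff-scale-*P : ∀ a f g k → coeff (map (a *ᶻ_) f *P g) k ≡ a *ᶻ coeff (f *P g) k
coeff-scale-*P a []      g k = sym (ℤP.*-zeroʳ a)
coeff-scale-*P a (b ∷ f) g k = begin
  coeff (((a *ᶻ b) ∷ map (a *ᶻ_) f) *P g) k
    ≡⟨ coeff-∷*P (a *ᶻ b) (map (a *ᶻ_) f) g k ⟩
  a *ᶻ b *ᶻ coeff g k +ᶻ coeff (+ 0 ∷ (map (a *ᶻ_) f *P g)) k
    ≡⟨ cong ((a *ᶻ b *ᶻ coeff g k) +ᶻ_) (shifted k) ⟩
  a *ᶻ b *ᶻ coeff g k +ᶻ a *ᶻ coeff (+ 0 ∷ (f *P g)) k
    ≡⟨ factor a b (coeff g k) _ ⟩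
  a *ᶻ (b *ᶻ coeff g k +ᶻ coeff (+ 0 ∷ (f *P g)) k)
    ≡⟨ cong (a *ᶻ_) (coeff-∷*P b f g k) ⟨
  a *ᶻ coeff ((b ∷ f) *P g) k ∎
  where
  open ≡-Reasoning
  shifted : ∀ k → coeff (+ 0 ∷ (map (a *ᶻ_) f *P g)) k ≡ a *ᶻ coeff (+ 0 ∷ (f *P g)) k
  shifted zero    = sym (ℤP.*-zeroʳ a)
  shifted (suc k) = coeff-scale-*P a f g k
  factor : ∀ x y z u → x *ᶻ y *ᶻ z +ᶻ x *ᶻ u ≡ x *ᶻ (y *ᶻ z +ᶻ u)
  factor = ℤSolver.solve-∀

coeff-shift-*P : ∀ f g → ((+ 0 ∷ f) *P g) ≈P (+ 0 ∷ (f *P g))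
coeff-shift-*P f g k = trans (coeff-∷*P (+ 0) f g k) (ℤP.+-identityˡ _)

*P-assoc : ∀ f g h → ((f *P g) *P h) ≈P (f *P (g *P h))
*P-assoc []      g h k = refl
*P-assoc (a ∷ f) g h k = begin
  coeff ((map (a *ᶻ_) g +P (+ 0 ∷ (f *P g))) *P h) k
    ≡⟨ *P-distribʳ h (map (a *ᶻ_) g) (+ 0 ∷ (f *P g)) k ⟩
  coeff ((map (a *ᶻ_) g *P h) +P ((+ 0 ∷ (f *P g)) *P h)) k
    ≡⟨ coeff-+P (map (a *ᶻ_) g *P h) _ k ⟩
  coeff (map (a *ᶻ_) g *P h) k +ᶻ coeff ((+ 0 ∷ (f *P g)) *P h) k
    ≡⟨ cong₂ _+ᶻ_ (coeff-scale-*P a g h k) (coeff-shift-*P (f *P g) h k) ⟩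
  a *ᶻ coeff (g *P h) k +ᶻ coeff (+ 0 ∷ ((f *P g) *P h)) k
    ≡⟨ cong ((a *ᶻ coeff (g *P h) k) +ᶻ_) (coeff-cong-∷ (*P-assoc f g h) k) ⟩
  a *ᶻ coeff (g *P h) k +ᶻ coeff (+ 0 ∷ (f *P (g *P h))) k
    ≡⟨ coeff-∷*P a f (g *P h) k ⟨
  coeff ((a ∷ f) *P (g *P h)) k ∎
  where open ≡-Reasoning

coeff-[0] : ∀ k → coeff [ + 0 ] k ≡ + 0
coeff-[0] zero    = refl
coeff-[0] (suc k) = refl

*P-identityˡ : ∀ f → (oneP *P f) ≈P f
*P-identityˡ f k = trans (coeff-∷*P (+ 1) [] f k)
  (trans (cong₂ _+ᶻ_ (ℤP.*-identityˡ (coeff f k)) (coeff-[0] k)) (ℤP.+-identityʳ (coeff f k)))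

-- Equal left factors may be lists of different lengths, so induction on them is awkward;
-- commutativity moves them to the right.
*P-cong : ∀ {f f′ g g′} → f ≈P f′ → g ≈P g′ → (f *P g) ≈P (f′ *P g′)
*P-cong {f} {f′} {g} {g′} p q k =
  trans (*P-congˡ f q k) (trans (*P-comm f g′ k) (trans (*P-congˡ g′ p k) (*P-comm g′ f′ k)))

+P-cong : ∀ {f f′ g g′} → f ≈P f′ → g ≈P g′ → (f +P g) ≈P (f′ +P g′)
+P-cong {f} {f′} {g} {g′} p q k =
  trans (coeff-+P f g k) (trans (cong₂ _+ᶻ_ (p k) (q k)) (sym (coeff-+P f′ g′ k)))

+P-comm : ∀ f g → (f +P g) ≈P (g +P f)
+P-comm f g k = trans (coeff-+P f g k) (trans (ℤP.+-comm (coeff f k) _) (sym (coeff-+P g f k)))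

+P-assoc : ∀ f g h → ((f +P g) +P h) ≈P (f +P (g +P h))
+P-assoc f g h k = begin
  coeff ((f +P g) +P h) k                    ≡⟨ coeff-+P (f +P g) h k ⟩
  coeff (f +P g) k +ᶻ coeff h k             ≡⟨ cong (_+ᶻ coeff h k) (coeff-+P f g k) ⟩
  coeff f k +ᶻ coeff g k +ᶻ coeff h k      ≡⟨ ℤP.+-assoc (coeff f k) _ _ ⟩
  coeff f k +ᶻ (coeff g k +ᶻ coeff h k)    ≡⟨ cong (coeff f k +ᶻ_) (coeff-+P g h k) ⟨
  coeff f k +ᶻ coeff (g +P h) k             ≡⟨ coeff-+P f (g +P h) k ⟨
  coeff (f +P (g +P h)) k                    ∎
  where open ≡-Reasoning

+P-inverseʳ : ∀ f → (f +P negP f) ≈P []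
+P-inverseʳ f k = trans (coeff-+P f (negP f) k) (trans (cong (coeff f k +ᶻ_) (coeff-neg f k)) (ℤP.+-inverseʳ (coeff f k)))

negP-cong : ∀ {f g} → f ≈P g → negP f ≈P negP g
negP-cong {f} {g} p k = trans (coeff-neg f k) (trans (cong neg (p k)) (sym (coeff-neg g k)))

ℤ-almostRing : AlmostCommutativeRing 0ℓ 0ℓ
ℤ-almostRing = fromCommutativeRing ℤP.+-*-commutativeRing

polyRing : CommutativeRing 0ℓ 0ℓ
polyRing = record
  { Carrier = Poly ; _≈_ = _≋_ ; _+_ = _+P_ ; _*_ = _*P_ ; -_ = negP ; 0# = [] ; 1# = oneP
  ; isCommutativeRing = record
    { isRing = record
      { +-isAbelianGroup = record
        { isGroup = record
          { isMonoid = record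
            { isSemigroup = record
              { isMagma = record
                { isEquivalence = record
                  { refl  = pointwise λ _ → refl
                  ; sym   = λ p → pointwise λ k → sym (coeffs p k)
                  ; trans = λ p q → pointwise λ k → trans (coeffs p k) (coeffs q k)
                  }
                ; ∙-cong = λ {f} {f′} {g} {g′} p q → pointwise (+P-cong {f} {f′} {g} {g′} (coeffs p) (coeffs q))
                }
              ; assoc = λ f g h → pointwise (+P-assoc f g h)
              }
            ; identity = (λ f → pointwise λ _ → refl) , (λ f → pointwise (+P-comm f []))
            }
          ; inverse = (λ f → pointwise λ k → trans (+P-comm (negP f) f k) (+P-inverseʳ f k))
                    , (λ f → pointwise (+P-inverseʳ f))
          ; ⁻¹-cong = λ {f} {g} p → pointwise (negP-cong {f} {g} (coeffs p))
          }
        ; comm = λ f g → pointwise (+P-comm f g)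
        }
      ; *-cong = λ {f} {f′} {g} {g′} p q → pointwise (*P-cong {f} {f′} {g} {g′} (coeffs p) (coeffs q))
      ; *-assoc = λ f g h → pointwise (*P-assoc f g h)
      ; *-identity = (λ f → pointwise (*P-identityˡ f))
                   , (λ f → pointwise λ k → trans (*P-comm f oneP k) (*P-identityˡ f k))
      ; distrib = (λ f g h → pointwise λ k → trans (*P-comm f (g +P h) k)
                    (trans (*P-distribʳ f g h k) (+P-cong {g *P f} {f *P g} {h *P f} {f *P h} (*P-comm g f) (*P-comm h f) k)))
                , (λ h f g → pointwise (*P-distribʳ h f g))
      }
    ; *-comm = λ f g → pointwise (*P-comm f g)
    }
  }

module Poly = CommutativeRing polyRing

constantMorphism : AlmostCommutativeRing.rawRing ℤ-almostRing -Raw-AlmostCommutative⟶ fromCommutativeRing polyRing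
constantMorphism = record
  { ⟦_⟧    = [_]
  ; +-homo = λ _ _ → Poly.refl
  ; *-homo = λ a b → pointwise λ { zero → sym (ℤP.+-identityʳ (a *ᶻ b)) ; (suc k) → refl }
  ; -‿homo = λ _ → Poly.refl
  ; 0-homo = pointwise λ { zero → refl ; (suc k) → refl }
  ; 1-homo = Poly.refl
  }

constant≋? : (a b : ℤ) → Maybe ([ a ] ≋ [ b ])
constant≋? a b = dec⇒maybe (map′ (λ { refl → Poly.refl }) (λ p → coeffs p 0) (a ℤP.≟ b))

-- Taking ℤ, rather than Poly, as the ring of constants makes the normal forms canonical:
-- [] and [ + 0 ] are different lists.
module PolySolver = RingSolver (AlmostCommutativeRing.rawRing ℤ-almostRing)
  (fromCommutativeRing polyRing) constantMorphism constant≋?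

-- Multiplication by powers of x

coeff-xPow-≡ : ∀ a → coeff (xPow a) a ≡ + 1
coeff-xPow-≡ zero    = refl
coeff-xPow-≡ (suc a) = coeff-xPow-≡ a

coeff-xPow-≢ : ∀ a k → k ≢ a → coeff (xPow a) k ≡ + 0
coeff-xPow-≢ zero    zero    k≢a = contradiction refl k≢a
coeff-xPow-≢ zero    (suc k) k≢a = refl
coeff-xPow-≢ (suc a) zero    k≢a = refl
coeff-xPow-≢ (suc a) (suc k) k≢a = coeff-xPow-≢ a k (k≢a ∘ cong suc)

coeff-xPow-nonneg : ∀ a k → + 0 ℤ.≤ coeff (xPow a) k
coeff-xPow-nonneg a k with k ℕP.≟ a
... | yes refl = subst (+ 0 ℤ.≤_) (sym (coeff-xPow-≡ k)) (ℤ.+≤+ z≤n)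
... | no  k≢a  = ℤP.≤-reflexive (sym (coeff-xPow-≢ a k k≢a))

shift-*P : ∀ f g → ((+ 0 ∷ f) *P g) ≋ (+ 0 ∷ (f *P g))
shift-*P f g = pointwise (coeff-shift-*P f g)

coeff-xPow-*P-< : ∀ a f k → k < a → coeff (xPow a *P f) k ≡ + 0
coeff-xPow-*P-< (suc a) f zero    _         = coeff-shift-*P (xPow a) f 0
coeff-xPow-*P-< (suc a) f (suc k) (s≤s k<a) =
  trans (coeff-shift-*P (xPow a) f (suc k)) (coeff-xPow-*P-< a f k k<a)

coeff-xPow-*P-+ : ∀ a f k → coeff (xPow a *P f) (a + k) ≡ coeff f k
coeff-xPow-*P-+ zero    f k = *P-identityˡ f k
coeff-xPow-*P-+ (suc a) f k = trans (coeff-shift-*P (xPow a) f (suc (a + k))) (coeff-xPow-*P-+ a f k)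

xPow-+ : ∀ a b → xPow (a + b) ≋ (xPow a *P xPow b)
xPow-+ zero    b = Poly.sym (Poly.*-identityˡ (xPow b))
xPow-+ (suc a) b = Poly.trans (pointwise (coeff-cong-∷ (coeffs (xPow-+ a b)))) (Poly.sym (shift-*P (xPow a) (xPow b)))

-- Turns scaling by `map`, opaque to the ring solver, into a product that it can handle.
scale-≋ : ∀ c f → map (c *ᶻ_) f ≋ ([ c ] *P f)
scale-≋ c f = pointwise λ k → sym (trans (coeff-∷*P c [] f k)
  (trans (cong₂ _+ᶻ_ (sym (coeff-scale c f k)) (coeff-[0] k)) (ℤP.+-identityʳ (coeff (map (c *ᶻ_) f) k))))

-- Sums of monomials

-- A coefficient counts the occurrences of its exponent, so nonnegativity is automatic and a list
-- without repetitions has coefficients at most 1.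
Σx : List ℕ → Poly
Σx es = foldr _+P_ [] (map xPow es)

Σx-nonneg : ∀ es k → + 0 ℤ.≤ coeff (Σx es) k
Σx-nonneg []       k = ℤP.≤-refl
Σx-nonneg (a ∷ es) k = subst (+ 0 ℤ.≤_) (sym (coeff-+P (xPow a) (Σx es) k))
  (ℤP.+-mono-≤ (coeff-xPow-nonneg a k) (Σx-nonneg es k))

Σx-∉ : ∀ {k es} → All (k ≢_) es → coeff (Σx es) k ≡ + 0
Σx-∉ [] = refl
Σx-∉ {k} {a ∷ es} (k≢a ∷ k∉es) = trans (coeff-+P (xPow a) (Σx es) k) (cong₂ _+ᶻ_ (coeff-xPow-≢ a k k≢a) (Σx-∉ k∉es))

Σx-unique : ∀ {es} → Unique es → ∀ k → coeff (Σx es) k ℤ.≤ + 1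
Σx-unique [] k = ℤ.+≤+ z≤n
Σx-unique {a ∷ es} (a∉es ∷ u) k with k ℕP.≟ a
... | yes refl = ℤP.≤-reflexive (trans (coeff-+P (xPow a) (Σx es) a) (cong₂ _+ᶻ_ (coeff-xPow-≡ a) (Σx-∉ a∉es)))
... | no  k≢a  = subst (ℤ._≤ + 1)
  (sym (trans (coeff-+P (xPow a) (Σx es) k) (trans (cong (_+ᶻ coeff (Σx es) k) (coeff-xPow-≢ a k k≢a)) (ℤP.+-identityˡ (coeff (Σx es) k)))))
  (Σx-unique u k)

Σx-++ : ∀ ds es → Σx (ds ++ es) ≋ (Σx ds +P Σx es)
Σx-++ []       es = Poly.refl
Σx-++ (a ∷ ds) es = Poly.trans (Poly.+-congˡ {xPow a} (Σx-++ ds es)) (Poly.sym (Poly.+-assoc (xPow a) (Σx ds) (Σx es)))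

-- Each monomial x^(e i) becomes x^(e (i+1)) - x^(e i). Allowing any arithmetic progression covers
-- the multiples of p, the interval below q and the residue classes modulo q.
Σx-telescope : ∀ s (e : ℕ → ℕ) → (∀ i → e (suc i) ≡ s + e i) → ∀ m →
  (xPowMinus1 s *P Σx (applyUpTo e m)) ≋ (xPow (e m) +P negP (xPow (e 0)))
Σx-telescope s e step zero    = Poly.trans (Poly.zeroʳ (xPowMinus1 s)) (Poly.sym (Poly.-‿inverseʳ (xPow (e 0))))
Σx-telescope s e step (suc m) = begin
  xPowMinus1 s *P (xPow (e 0) +P S)
    ≈⟨ solve 3 (λ x y z → (x :+ :- con (+ 1)) :* (y :+ z) := (x :* y :+ :- y) :+ (x :+ :- con (+ 1)) :* z)
             Poly.refl (xPow s) (xPow (e 0)) S ⟩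
  ((xPow s *P xPow (e 0)) +P negP (xPow (e 0))) +P (xPowMinus1 s *P S)
    ≈⟨ Poly.+-cong (Poly.+-congʳ (Poly.trans (Poly.sym (xPow-+ s (e 0))) (Poly.reflexive (cong xPow (sym (step 0))))))
                   (Σx-telescope s (e ∘ suc) (step ∘ suc) m) ⟩
  (xPow (e 1) +P negP (xPow (e 0))) +P (xPow (e (suc m)) +P negP (xPow (e 1)))
    ≈⟨ solve 3 (λ x y z → (x :+ :- y) :+ (z :+ :- x) := z :+ :- y) Poly.refl (xPow (e 1)) (xPow (e 0)) (xPow (e (suc m))) ⟩
  xPow (e (suc m)) +P negP (xPow (e 0)) ∎
  where
  open PolySolver
  open import Relation.Binary.Reasoning.Setoid Poly.setoid
  S = Σx (applyUpTo (e ∘ suc) m)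

module _ {c ℓ} (M : CommutativeMonoid c ℓ) where
  open CommutativeMonoid M using (Carrier; _≈_; _∙_; ε; ∙-congˡ; ∙-congʳ; assoc; comm)
    renaming (refl to ≈-refl; sym to ≈-sym; trans to ≈-trans)

  -- Applied to addition, where residues are permuted, and to multiplication, where unitary divisors
  -- are.
  foldr-map-↭ : ∀ {a} {A : Set a} (f : A → Carrier) {xs ys} → xs ↭ ys →
    foldr _∙_ ε (map f xs) ≈ foldr _∙_ ε (map f ys)
  foldr-map-↭ f ↭.refl         = ≈-refl
  foldr-map-↭ f (↭.prep x p)   = ∙-congˡ (foldr-map-↭ f p)
  foldr-map-↭ f (↭.swap x y p) = ≈-trans (∙-congˡ (∙-congˡ (foldr-map-↭ f p)))
    (≈-trans (≈-sym (assoc (f x) (f y) _)) (≈-trans (∙-congʳ (comm (f x) (f y))) (assoc (f y) (f x) _)))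
  foldr-map-↭ f (↭.trans p q)  = ≈-trans (foldr-map-↭ f p) (foldr-map-↭ f q)

-- The unitary cyclotomic polynomial of pq

module _ (q : ℕ) .{{_ : NonZero q}} where

  -- The exponents of (x^n - x^(n mod q))/(x^q - 1).
  quotientExponents : ℕ → List ℕ
  quotientExponents n = applyUpTo (λ j → j * q + n % q) (n / q)

  divMod-≡ : ∀ n → n / q * q + n % q ≡ n
  divMod-≡ n = trans (ℕP.+-comm _ (n % q)) (sym (m≡m%n+[m/n]*n n q))

  xPow-divMod : ∀ n → xPow n ≋ ((xPowMinus1 q *P Σx (quotientExponents n)) +P xPow (n % q))
  xPow-divMod n = begin
    xPow n
      ≈⟨ Poly.reflexive (cong xPow (divMod-≡ n)) ⟨
    xPow (n / q * q + n % q)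
      ≈⟨ solve 2 (λ x y → x := (x :+ :- y) :+ y) Poly.refl (xPow (n / q * q + n % q)) (xPow (n % q)) ⟩
    (xPow (n / q * q + n % q) +P negP (xPow (n % q))) +P xPow (n % q)
      ≈⟨ Poly.+-congʳ (Σx-telescope q (λ j → j * q + n % q) (λ j → ℕP.+-assoc q (j * q) (n % q)) (n / q)) ⟨
    (xPowMinus1 q *P Σx (quotientExponents n)) +P xPow (n % q) ∎
    where
    open PolySolver
    open import Relation.Binary.Reasoning.Setoid Poly.setoid

  -- The lists of quotient exponents are merely concatenated and could overlap, so a bound on the
  -- coefficients of the quotient needs the separate argument of `quotient-coeff≤1`.
  Σx-divMod : ∀ es → Σx es ≋ ((xPowMinus1 q *P Σx (concatMap quotientExponents es)) +P Σx (map (_% q) es))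
  Σx-divMod []       = Poly.sym (Poly.trans (Poly.+-identityʳ (xPowMinus1 q *P [])) (Poly.zeroʳ (xPowMinus1 q)))
  Σx-divMod (n ∷ es) = begin
    xPow n +P Σx es
      ≈⟨ Poly.+-cong (xPow-divMod n) (Σx-divMod es) ⟩
    ((xPowMinus1 q *P S) +P x) +P ((xPowMinus1 q *P T) +P U)
      ≈⟨ solve 5 (λ a s t b c → (a :* s :+ b) :+ (a :* t :+ c) := a :* (s :+ t) :+ (b :+ c)) Poly.refl (xPowMinus1 q) S T x U ⟩
    (xPowMinus1 q *P (S +P T)) +P (x +P U)
      ≈⟨ Poly.+-congʳ (Poly.*-congˡ {xPowMinus1 q} (Σx-++ (quotientExponents n) (concatMap quotientExponents es))) ⟨
    (xPowMinus1 q *P Σx (concatMap quotientExponents (n ∷ es))) +P Σx (map (_% q) (n ∷ es)) ∎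
    where
    open PolySolver
    open import Relation.Binary.Reasoning.Setoid Poly.setoid
    S = Σx (quotientExponents n)
    T = Σx (concatMap quotientExponents es)
    x = xPow (n % q)
    U = Σx (map (_% q) es)

  quotientExponents-bound : ∀ {M es} → All (_≤ M) es → All (λ e → q + e ≤ M) (concatMap quotientExponents es)
  quotientExponents-bound []       = []
  quotientExponents-bound {M} {n ∷ es} (n≤M ∷ es≤M) = All.++⁺
    (All.applyUpTo⁺₁ (λ j → j * q + n % q) (n / q) λ {j} j<n/q → begin
      q + (j * q + n % q)   ≡⟨ ℕP.+-assoc q (j * q) (n % q) ⟨
      suc j * q + n % q     ≤⟨ ℕP.+-monoˡ-≤ (n % q) (ℕP.*-monoˡ-≤ q j<n/q) ⟩
      n / q * q + n % q     ≡⟨ divMod-≡ n ⟩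
      n                     ≤⟨ n≤M ⟩
      M                     ∎)
    (quotientExponents-bound es≤M)
    where open ℕP.≤-Reasoning

  -- Comparing coefficients of A + Q = x^q Q + G gives Q_k ≤ Q_{k-q} + G_k.
  quotient-coeff≤1 : ∀ {A Q G} → A ≋ ((xPowMinus1 q *P Q) +P G) →
    (∀ k → + 0 ℤ.≤ coeff A k) → (∀ k → coeff G k ℤ.≤ + 1) → (∀ k → q ≤ k → coeff G k ℤ.≤ + 0) →
    ∀ k → coeff Q k ℤ.≤ + 1
  quotient-coeff≤1 {A} {Q} {G} A≋ A≥0 G≤1 G≤0 = <-rec _ bound
    where
    open PolySolver
    A+Q≋ : (A +P Q) ≋ ((xPow q *P Q) +P G)
    A+Q≋ = Poly.trans (Poly.+-congʳ A≋)
      (solve 3 (λ x y z → ((x :+ :- con (+ 1)) :* y :+ z) :+ y := x :* y :+ z) Poly.refl (xPow q) Q G)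
    Q≤ : ∀ k → coeff Q k ℤ.≤ coeff (xPow q *P Q) k +ᶻ coeff G k
    Q≤ k = begin
      coeff Q k                                ≡⟨ ℤP.+-identityˡ (coeff Q k) ⟨
      + 0 +ᶻ coeff Q k                         ≤⟨ ℤP.+-monoˡ-≤ (coeff Q k) (A≥0 k) ⟩
      coeff A k +ᶻ coeff Q k                   ≡⟨ coeff-+P A Q k ⟨
      coeff (A +P Q) k                         ≡⟨ coeffs A+Q≋ k ⟩
      coeff ((xPow q *P Q) +P G) k             ≡⟨ coeff-+P (xPow q *P Q) G k ⟩
      coeff (xPow q *P Q) k +ᶻ coeff G k       ∎
      where open ℤP.≤-Reasoning
    bound : ∀ k → (∀ {j} → j < k → coeff Q j ℤ.≤ + 1) → coeff Q k ℤ.≤ + 1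
    bound k rec with k ℕP.<? q
    -- Below q the shifted term vanishes and G gives at most 1; from q on, G adds nothing positive
    -- and the shifted term is an earlier coefficient of Q.
    ... | yes k<q = ℤP.≤-trans (Q≤ k) (ℤP.+-mono-≤ (ℤP.≤-reflexive (coeff-xPow-*P-< q Q k k<q)) (G≤1 k))
    ... | no  k≮q = ℤP.≤-trans (Q≤ k) (ℤP.+-mono-≤ shifted≤1 (G≤0 k q≤k))
      where
      q≤k = ℕP.≮⇒≥ k≮q
      shifted≤1 : coeff (xPow q *P Q) k ℤ.≤ + 1
      shifted≤1 = subst (ℤ._≤ + 1)
        (trans (sym (coeff-xPow-*P-+ q Q (k ∸ q))) (cong (coeff (xPow q *P Q)) (ℕP.m+[n∸m]≡n q≤k)))
        (rec (ℕP.∸-monoʳ-< {k} {q} {0} (ℕ.>-nonZero⁻¹ q) q≤k))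

-- The difference is written in the shape that multiplication by x - 1 produces.
∣a-b∣≤1 : ∀ {a b} → + 0 ℤ.≤ a → a ℤ.≤ + 1 → + 0 ℤ.≤ b → b ℤ.≤ + 1 → ∣ -[1+ 0 ] *ᶻ b +ᶻ a ∣ ≤ 1
∣a-b∣≤1 (ℤ.+≤+ _) (ℤ.+≤+ z≤n)       (ℤ.+≤+ _) (ℤ.+≤+ z≤n)       = z≤n
∣a-b∣≤1 (ℤ.+≤+ _) (ℤ.+≤+ (s≤s z≤n)) (ℤ.+≤+ _) (ℤ.+≤+ z≤n)       = s≤s z≤n
∣a-b∣≤1 (ℤ.+≤+ _) (ℤ.+≤+ z≤n)       (ℤ.+≤+ _) (ℤ.+≤+ (s≤s z≤n)) = s≤s z≤n
∣a-b∣≤1 (ℤ.+≤+ _) (ℤ.+≤+ (s≤s z≤n)) (ℤ.+≤+ _) (ℤ.+≤+ (s≤s z≤n)) = z≤n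

-- The added constant 1 plays the part of a coefficient of Q at index -1, so even the constant term
-- is a difference of two numbers in {0, 1}.
coeff-x-1-*P+1-zero : ∀ Q → coeff ((xPowMinus1 1 *P Q) +P oneP) 0 ≡ -[1+ 0 ] *ᶻ coeff Q 0 +ᶻ + 1
coeff-x-1-*P+1-zero Q = trans (coeff-+P (xPowMinus1 1 *P Q) oneP 0)
  (cong (_+ᶻ + 1) (trans (coeff-∷*P -[1+ 0 ] oneP Q 0) (ℤP.+-identityʳ (-[1+ 0 ] *ᶻ coeff Q 0))))

coeff-x-1-*P+1-suc : ∀ Q k → coeff ((xPowMinus1 1 *P Q) +P oneP) (suc k) ≡ -[1+ 0 ] *ᶻ coeff Q (suc k) +ᶻ coeff Q k
coeff-x-1-*P+1-suc Q k = trans (coeff-+P (xPowMinus1 1 *P Q) oneP (suc k)) (trans (ℤP.+-identityʳ (coeff (xPowMinus1 1 *P Q) (suc k)))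
  (trans (coeff-∷*P -[1+ 0 ] oneP Q (suc k)) (cong (_+ᶻ_ (-[1+ 0 ] *ᶻ coeff Q (suc k))) (*P-identityˡ Q k))))

unique-↭ : ∀ {xs ys : List ℕ} → Unique xs → Unique ys →
  (∀ {x} → x ∈ xs → x ∈ ys) → (∀ {x} → x ∈ ys → x ∈ xs) → xs ↭ ys
unique-↭ u v f g = ∼bag⇒↭ (unique∧set⇒bag u v (mk⇔ f g))

-- Multiples of p modulo q

module _ (p q : ℕ) .{{_ : NonZero q}} (p⊥q : Coprime p q) where

  -- If 1 + x p is a multiple of q then x p is its own inverse modulo q.
  modular-inverse : ∃ λ u → (p * u) % q ≡ 1 % q
  modular-inverse with coprime-Bézout p⊥q
  ... | Bézout.+- x y eq = x , trans (cong (_% q) (trans (ℕP.*-comm p x) (sym eq))) ([m+kn]%n≡m%n 1 y q)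
  ... | Bézout.-+ x y eq = x * (x * p) , (begin
    (p * (x * (x * p))) % q                   ≡⟨ %-remove-+ʳ (p * (x * (x * p))) (divides y eq) ⟨
    (p * (x * (x * p)) + (1 + x * p)) % q     ≡⟨ cong (_% q) (rearrange p x) ⟩
    (1 + x * p * (1 + x * p)) % q             ≡⟨ %-remove-+ʳ 1 (∣n⇒∣m*n (x * p) (divides y eq)) ⟩
    1 % q                                     ∎)
    where
    open ≡-Reasoning
    rearrange : ∀ p x → p * (x * (x * p)) + (1 + x * p) ≡ 1 + x * p * (1 + x * p)
    rearrange = solve-∀

  %-*-congˡ : ∀ {a b} c → a % q ≡ b % q → (a * c) % q ≡ (b * c) % q
  %-*-congˡ {a} {b} c eq = trans (%-distribˡ-* a c q) (trans (cong (λ m → (m * (c % q)) % q) eq) (sym (%-distribˡ-* b c q)))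

  -- The inverse u of p modulo q gives injectivity by cancellation, and it gives x u mod q as the
  -- index whose multiple of p has residue x.
  multiples-%-↭ : map (_% q) (applyUpTo (_* p) q) ↭ upTo q
  multiples-%-↭ with u , pu≡1 ← modular-inverse =
    subst (_↭ upTo q) (sym (map-applyUpTo (_* p) (_% q) q))
      (unique-↭ (Unique.applyUpTo⁺₁ residue q λ i<j j<q eq → ℕP.<⇒≢ i<j (injective (ℕP.<-trans i<j j<q) j<q eq)) (Unique.upTo⁺ q) sub sup)
    where
    residue : ℕ → ℕ
    residue i = (i * p) % q
    cancel : ∀ i → (p * u * i) % q ≡ i % q
    cancel i = trans (%-*-congˡ i pu≡1) (cong (_% q) (ℕP.*-identityˡ i))
    injective : ∀ {i j} → i < q → j < q → residue i ≡ residue j → i ≡ j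
    injective {i} {j} i<q j<q eq = begin
      i                    ≡⟨ m<n⇒m%n≡m i<q ⟨
      i % q                ≡⟨ cancel i ⟨
      (p * u * i) % q      ≡⟨ cong (_% q) (rotate p u i) ⟩
      (i * p * u) % q      ≡⟨ %-*-congˡ u eq ⟩
      (j * p * u) % q      ≡⟨ cong (_% q) (rotate p u j) ⟨
      (p * u * j) % q      ≡⟨ cancel j ⟩
      j % q                ≡⟨ m<n⇒m%n≡m j<q ⟩
      j                    ∎
      where
      open ≡-Reasoning
      rotate : ∀ p u i → p * u * i ≡ i * p * u
      rotate = solve-∀
    sub : ∀ {x} → x ∈ applyUpTo residue q → x ∈ upTo q
    sub x∈ with i , _ , refl ← ∈-applyUpTo⁻ residue x∈ = ∈-upTo⁺ (m%n<n (i * p) q)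
    sup : ∀ {x} → x ∈ upTo q → x ∈ applyUpTo residue q
    sup {x} x∈ = subst (_∈ applyUpTo residue q) eq (∈-applyUpTo⁺ residue (m%n<n (x * u) q))
      where
      open ≡-Reasoning
      rotate : ∀ p u x → x * u * p ≡ p * u * x
      rotate = solve-∀
      eq : residue ((x * u) % q) ≡ x
      eq = begin
        ((x * u) % q * p) % q   ≡⟨ %-*-congˡ p (m%n%n≡m%n (x * u) q) ⟩
        (x * u * p) % q         ≡⟨ cong (_% q) (rotate p u x) ⟩
        (p * u * x) % q         ≡⟨ cancel x ⟩
        x % q                   ≡⟨ m<n⇒m%n≡m (∈-upTo⁻ x∈) ⟩
        x                       ∎

-- With A = Σ_{i<q} x^{ip}, dividing by x^q - 1 leaves Σ_{i<q} x^i, since i ↦ ip permutes the residues modulo q.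
-- So A = (x^q - 1) Q + (x^q - 1)/(x - 1), and Φ = (x - 1) Q + 1 where Q has coefficients 0 and 1.
binary-cyclotomic : ∀ p q → .{{NonZero p}} → .{{NonZero q}} → Coprime p q → Σ Poly λ Φ →
  (((Φ *P xPowMinus1 p) *P xPowMinus1 q) ≋ (xPowMinus1 (p * q) *P xPowMinus1 1)) ×
  (∀ k → ∣ coeff Φ k ∣ ≤ 1) ×
  (∀ k → (p ∸ 1) * (q ∸ 1) < k → coeff Φ k ≡ + 0)
binary-cyclotomic p@(suc p′) q@(suc q′) p⊥q = Φ , identity , Φ-bound , Φ-degree
  where
  exponents = concatMap (quotientExponents q) (applyUpTo (_* p) q)
  A = Σx (applyUpTo (_* p) q)
  Q = Σx exponents
  G = Σx (upTo q)
  Φ = (xPowMinus1 1 *P Q) +P oneP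

  A≋ : A ≋ ((xPowMinus1 q *P Q) +P G)
  A≋ = Poly.trans (Σx-divMod q (applyUpTo (_* p) q)) (Poly.+-congˡ {xPowMinus1 q *P Q} (foldr-map-↭ Poly.+-commutativeMonoid xPow (multiples-%-↭ p q p⊥q)))

  identity : ((Φ *P xPowMinus1 p) *P xPowMinus1 q) ≋ (xPowMinus1 (p * q) *P xPowMinus1 1)
  identity = begin
    ((((X 1 *P Q) +P oneP) *P X p) *P X q)
      ≈⟨ solve 4 (λ a b c d → ((a :* d :+ con (+ 1)) :* b) :* c := b :* (a :* (c :* d) :+ c)) Poly.refl (X 1) (X p) (X q) Q ⟩
    X p *P ((X 1 *P (X q *P Q)) +P X q)
      -- Writing x^q - 1 as (x - 1) G lets x - 1 be factored out, and what it multiplies is A.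
      ≈⟨ Poly.*-congˡ {X p} (Poly.+-congˡ {X 1 *P (X q *P Q)} (Σx-telescope 1 (λ i → i) (λ _ → refl) q)) ⟨
    X p *P ((X 1 *P (X q *P Q)) +P (X 1 *P G))
      ≈⟨ solve 4 (λ a b c d → b :* (a :* c :+ a :* d) := (b :* (c :+ d)) :* a) Poly.refl (X 1) (X p) (X q *P Q) G ⟩
    (X p *P ((X q *P Q) +P G)) *P X 1
      ≈⟨ Poly.*-congʳ {X 1} (Poly.*-congˡ {X p} A≋) ⟨
    (X p *P A) *P X 1
      ≈⟨ Poly.*-congʳ {X 1} (Σx-telescope p (_* p) (λ _ → refl) q) ⟩
    X (q * p) *P X 1
      ≈⟨ Poly.*-congʳ {X 1} (Poly.reflexive (cong X (ℕP.*-comm q p))) ⟩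
    X (p * q) *P X 1 ∎
    where
    X = xPowMinus1
    open PolySolver
    open import Relation.Binary.Reasoning.Setoid Poly.setoid

  Q≥0 = Σx-nonneg exponents

  Q≤1 : ∀ k → coeff Q k ℤ.≤ + 1
  Q≤1 = quotient-coeff≤1 q {A} {Q} {G} A≋ (Σx-nonneg (applyUpTo (_* p) q)) (Σx-unique (Unique.upTo⁺ q))
    λ k q≤k → ℤP.≤-reflexive (Σx-∉ (All.map (λ a<q → ℕP.>⇒≢ (ℕP.<-≤-trans a<q q≤k)) (All.all-upTo q)))

  Φ-bound : ∀ k → ∣ coeff Φ k ∣ ≤ 1
  Φ-bound zero    = subst (λ c → ∣ c ∣ ≤ 1) (sym (coeff-x-1-*P+1-zero Q))
    (∣a-b∣≤1 (ℤ.+≤+ z≤n) (ℤ.+≤+ (s≤s z≤n)) (Q≥0 0) (Q≤1 0))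
  Φ-bound (suc k) = subst (λ c → ∣ c ∣ ≤ 1) (sym (coeff-x-1-*P+1-suc Q k))
    (∣a-b∣≤1 (Q≥0 k) (Q≤1 k) (Q≥0 (suc k)) (Q≤1 (suc k)))

  exponents-bound : All (λ e → q + e ≤ q′ * p) exponents
  exponents-bound = quotientExponents-bound q
    (All.applyUpTo⁺₁ (_* p) q λ { (s≤s i≤q′) → ℕP.*-monoˡ-≤ p i≤q′ })

  -- The largest exponent in A is (q - 1)p, so those in Q are at most (q - 1)p - q = (p - 1)(q - 1)
  -- - 1; the factor x - 1 in Φ then raises the degree to at most (p - 1)(q - 1).
  Q-degree : ∀ k → p′ * q′ ≤ k → coeff Q k ≡ + 0
  Q-degree k D≤k = Σx-∉ (All.map (λ {e} bound → ℕP.>⇒≢ (ℕP.<-≤-trans (e<D e bound) D≤k)) exponents-bound)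
    where
    e<D : ∀ e → q + e ≤ q′ * p → e < p′ * q′
    e<D e bound = ℕP.+-cancelˡ-≤ q′ (suc e) (p′ * q′) (begin
      q′ + suc e       ≡⟨ ℕP.+-suc q′ e ⟩
      q + e            ≤⟨ bound ⟩
      q′ * suc p′      ≡⟨ ℕP.*-suc q′ p′ ⟩
      q′ + q′ * p′     ≡⟨ cong (ℕ._+_ q′) (ℕP.*-comm q′ p′) ⟩
      q′ + p′ * q′     ∎)
      where open ℕP.≤-Reasoning

  Φ-degree : ∀ k → p′ * q′ < k → coeff Φ k ≡ + 0
  Φ-degree (suc k) (s≤s D≤k) = trans (coeff-x-1-*P+1-suc Q k)
    (cong₂ (λ a b → -[1+ 0 ] *ᶻ a +ᶻ b) (Q-degree (suc k) (ℕP.m≤n⇒m≤1+n D≤k)) (Q-degree k D≤k))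

-- The coefficients of Φ(x) B(x^r)

H-bound : ∀ f {M} → (∀ k → ∣ coeff f k ∣ ≤ M) → H f ≤ M
H-bound []      bound = z≤n
H-bound (a ∷ f) bound = ℕP.⊔-lub (bound 0) (H-bound f λ k → bound (suc k))

module _ (Φ : Poly) (r : ℕ) where

  -- bs = b₀, b₁, … gives Φ(x) Σ_j b_j x^{rj}, in Horner form.
  shiftedSum : List ℤ → Poly
  shiftedSum []       = []
  shiftedSum (b ∷ bs) = map (b *ᶻ_) Φ +P (xPow r *P shiftedSum bs)

  -- With y = x^r, a block of m equal coefficients c contributes c Φ (y^m - 1)/(y - 1) and displaces
  -- the rest by y^m; multiplying by y - 1 clears the denominator.
  shiftedSum-replicate : ∀ c m bs → (xPowMinus1 r *P shiftedSum (replicate m c ++ bs)) ≋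
    ((([ c ] *P Φ) *P xPowMinus1 (m * r)) +P (xPow (m * r) *P (xPowMinus1 r *P shiftedSum bs)))
  shiftedSum-replicate c zero bs =
    solve 2 (λ a y → y := a :* (con (+ 1) :+ :- con (+ 1)) :+ con (+ 1) :* y) Poly.refl
      ([ c ] *P Φ) (xPowMinus1 r *P shiftedSum bs)
    where open PolySolver
  shiftedSum-replicate c (suc m) bs = begin
    X r *P (map (c *ᶻ_) Φ +P (xPow r *P S))
      ≈⟨ Poly.*-congˡ {X r} (Poly.+-congʳ {xPow r *P S} (scale-≋ c Φ)) ⟩
    X r *P (cΦ +P (xPow r *P S))
      ≈⟨ solve 3 (λ x a s → (x :+ :- con (+ 1)) :* (a :+ x :* s) := (x :+ :- con (+ 1)) :* a :+ x :* ((x :+ :- con (+ 1)) :* s))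
               Poly.refl (xPow r) cΦ S ⟩
    (X r *P cΦ) +P (xPow r *P (X r *P S))
      ≈⟨ Poly.+-congˡ {X r *P cΦ} (Poly.*-congˡ {xPow r} (shiftedSum-replicate c m bs)) ⟩
    (X r *P cΦ) +P (xPow r *P ((cΦ *P X (m * r)) +P (xPow (m * r) *P T)))
      ≈⟨ solve 4 (λ x y a t → (x :+ :- con (+ 1)) :* a :+ x :* (a :* (y :+ :- con (+ 1)) :+ y :* t)
                            := a :* (x :* y :+ :- con (+ 1)) :+ (x :* y) :* t) Poly.refl (xPow r) (xPow (m * r)) cΦ T ⟩
    (cΦ *P ((xPow r *P xPow (m * r)) +P negP oneP)) +P ((xPow r *P xPow (m * r)) *P T)
      ≈⟨ Poly.+-cong (Poly.*-congˡ {cΦ} (Poly.+-congʳ {negP oneP} (xPow-+ r (m * r)))) (Poly.*-congʳ {T} (xPow-+ r (m * r))) ⟨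
    (cΦ *P X (suc m * r)) +P (xPow (suc m * r) *P T) ∎
    where
    open PolySolver
    open import Relation.Binary.Reasoning.Setoid Poly.setoid
    X = xPowMinus1
    S = shiftedSum (replicate m c ++ bs)
    T = X r *P shiftedSum bs
    cΦ = [ c ] *P Φ

  coeff-shiftedSum-< : ∀ b bs k → k < r → coeff (shiftedSum (b ∷ bs)) k ≡ b *ᶻ coeff Φ k
  coeff-shiftedSum-< b bs k k<r = trans (coeff-+P (map (b *ᶻ_) Φ) _ k)
    (trans (cong₂ _+ᶻ_ (coeff-scale b Φ k) (coeff-xPow-*P-< r (shiftedSum bs) k k<r)) (ℤP.+-identityʳ (b *ᶻ coeff Φ k)))

  coeff-shiftedSum-≥ : ∀ b bs k → r ≤ k → coeff (shiftedSum (b ∷ bs)) k ≡ b *ᶻ coeff Φ k +ᶻ coeff (shiftedSum bs) (k ∸ r)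
  coeff-shiftedSum-≥ b bs k r≤k = trans (coeff-+P (map (b *ᶻ_) Φ) _ k) (cong₂ _+ᶻ_ (coeff-scale b Φ k)
    (trans (cong (coeff (xPow r *P shiftedSum bs)) (sym (ℕP.m+[n∸m]≡n r≤k))) (coeff-xPow-*P-+ r (shiftedSum bs) (k ∸ r))))

  module _ .{{_ : NonZero r}} (Φ≤1 : ∀ k → ∣ coeff Φ k ∣ ≤ 1) where

    scaled≤1 : ∀ b → ∣ b ∣ ≤ 1 → ∀ k → ∣ b *ᶻ coeff Φ k ∣ ≤ 1
    scaled≤1 b b≤1 k = subst (_≤ 1) (sym (ℤP.abs-* b (coeff Φ k))) (ℕP.*-mono-≤ b≤1 (Φ≤1 k))

    -- Only the copies shifted by at most k reach coefficient k. Dropping the first copy lowers both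
    -- k by r and the quotient k / r by 1.
    shiftedSum-coeff≤k/r+1 : ∀ bs → All (λ b → ∣ b ∣ ≤ 1) bs → ∀ k → ∣ coeff (shiftedSum bs) k ∣ ≤ k / r + 1
    shiftedSum-coeff≤k/r+1 [] [] k = z≤n
    shiftedSum-coeff≤k/r+1 (b ∷ bs) (b≤1 ∷ bs≤1) k with k ℕP.<? r
    ... | yes k<r = begin
      ∣ coeff (shiftedSum (b ∷ bs)) k ∣    ≡⟨ cong ∣_∣ (coeff-shiftedSum-< b bs k k<r) ⟩
      ∣ b *ᶻ coeff Φ k ∣                   ≤⟨ scaled≤1 b b≤1 k ⟩
      1                                    ≤⟨ ℕP.m≤n+m 1 (k / r) ⟩
      k / r + 1                            ∎
      where open ℕP.≤-Reasoning
    ... | no  k≮r = begin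
      ∣ coeff (shiftedSum (b ∷ bs)) k ∣                              ≡⟨ cong ∣_∣ (coeff-shiftedSum-≥ b bs k r≤k) ⟩
      ∣ b *ᶻ coeff Φ k +ᶻ coeff (shiftedSum bs) (k ∸ r) ∣            ≤⟨ ℤP.∣i+j∣≤∣i∣+∣j∣ (b *ᶻ coeff Φ k) (coeff (shiftedSum bs) (k ∸ r)) ⟩
      ∣ b *ᶻ coeff Φ k ∣ + ∣ coeff (shiftedSum bs) (k ∸ r) ∣         ≤⟨ ℕP.+-mono-≤ (scaled≤1 b b≤1 k) (shiftedSum-coeff≤k/r+1 bs bs≤1 (k ∸ r)) ⟩
      1 + (k ∸ r) / r + 1                                            ≡⟨ cong (_+ 1) (m/n≡1+[m∸n]/n r≤k) ⟨
      k / r + 1                                                      ∎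
      where
      open ℕP.≤-Reasoning
      r≤k = ℕP.≮⇒≥ k≮r

    shiftedSum-coeff≤ : ∀ {D} → (∀ k → D < k → coeff Φ k ≡ + 0) → ∀ bs → All (λ b → ∣ b ∣ ≤ 1) bs →
      ∀ k → ∣ coeff (shiftedSum bs) k ∣ ≤ D / r + 1
    shiftedSum-coeff≤ Φ-degree [] [] k = z≤n
    shiftedSum-coeff≤ {D} Φ-degree (b ∷ bs) (b≤1 ∷ bs≤1) k with k ℕP.≤? D
    ... | yes k≤D = ℕP.≤-trans (shiftedSum-coeff≤k/r+1 (b ∷ bs) (b≤1 ∷ bs≤1) k) (ℕP.+-monoˡ-≤ 1 (/-monoˡ-≤ r k≤D))
    ... | no  k≰D = tail-bound
      where
      bΦ≡0 : b *ᶻ coeff Φ k ≡ + 0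
      bΦ≡0 = trans (cong (b *ᶻ_) (Φ-degree k (ℕP.≰⇒> k≰D))) (ℤP.*-zeroʳ b)
      tail-bound : ∣ coeff (shiftedSum (b ∷ bs)) k ∣ ≤ D / r + 1
      tail-bound with k ℕP.<? r
      ... | yes k<r = subst (λ c → ∣ c ∣ ≤ D / r + 1) (sym (trans (coeff-shiftedSum-< b bs k k<r) bΦ≡0)) z≤n
      ... | no  k≮r = subst (λ c → ∣ c ∣ ≤ D / r + 1)
        (sym (trans (coeff-shiftedSum-≥ b bs k (ℕP.≮⇒≥ k≮r))
          (trans (cong (_+ᶻ coeff (shiftedSum bs) (k ∸ r)) bΦ≡0) (ℤP.+-identityˡ (coeff (shiftedSum bs) (k ∸ r))))))
        (shiftedSum-coeff≤ Φ-degree bs bs≤1 (k ∸ r))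

-- (y^p - 1)(y^q - 1)/(y - 1) has coefficients -1 on [0,p), 0 on [p,q) and 1 on [q,q+p).
inverseCoeffs : ℕ → ℕ → List ℤ
inverseCoeffs p q = replicate p -[1+ 0 ] ++ replicate (q ∸ p) (+ 0) ++ replicate p (+ 1) ++ []

inverseCoeffs≤1 : ∀ p q → All (λ b → ∣ b ∣ ≤ 1) (inverseCoeffs p q)
inverseCoeffs≤1 p q = All.++⁺ (All.replicate⁺ p (s≤s z≤n))
  (All.++⁺ (All.replicate⁺ (q ∸ p) z≤n) (All.++⁺ (All.replicate⁺ p (s≤s z≤n)) []))

shiftedSum-inverseCoeffs : ∀ Φ p q r → p ≤ q →
  (xPowMinus1 r *P shiftedSum Φ r (inverseCoeffs p q)) ≋ (Φ *P (xPowMinus1 (p * r) *P xPowMinus1 (q * r)))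
shiftedSum-inverseCoeffs Φ p q r p≤q = begin
  X r *P F (replicate p -[1+ 0 ] ++ replicate (q ∸ p) (+ 0) ++ replicate p (+ 1) ++ [])
    ≈⟨ shiftedSum-replicate Φ r -[1+ 0 ] p _ ⟩
  (([ -[1+ 0 ] ] *P Φ) *P X (p * r)) +P (y *P (X r *P F (replicate (q ∸ p) (+ 0) ++ replicate p (+ 1) ++ [])))
    ≈⟨ Poly.+-congˡ {a} (Poly.*-congˡ {y} (shiftedSum-replicate Φ r (+ 0) (q ∸ p) _)) ⟩
  a +P (y *P (b +P (z *P (X r *P F (replicate p (+ 1) ++ [])))))
    ≈⟨ Poly.+-congˡ {a} (Poly.*-congˡ {y} (Poly.+-congˡ {b} (Poly.*-congˡ {z} last-block))) ⟩
  a +P (y *P (b +P (z *P ((oneP *P Φ) *P X (p * r)))))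
    -- The zero block contributes only its shift z, leaving -(y - 1) + yz(y - 1) = (y - 1)(yz - 1),
    -- where yz = x^(qr).
    ≈⟨ solve 3 (λ φ y z → (:- con (+ 1) :* φ) :* (y :+ :- con (+ 1))
                          :+ y :* ((con (+ 0) :* φ) :* (z :+ :- con (+ 1))
                          :+ z :* ((con (+ 1) :* φ) :* (y :+ :- con (+ 1))))
                         := φ :* ((y :+ :- con (+ 1)) :* (y :* z :+ :- con (+ 1))))
             Poly.refl Φ y z ⟩
  Φ *P (X (p * r) *P ((y *P z) +P negP oneP))
    ≈⟨ Poly.*-congˡ {Φ} (Poly.*-congˡ {X (p * r)} (Poly.+-congʳ {negP oneP}
           (Poly.trans (Poly.reflexive (cong xPow exponent)) (xPow-+ (p * r) ((q ∸ p) * r))))) ⟨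
  Φ *P (X (p * r) *P X (q * r)) ∎
  where
  open PolySolver
  open import Relation.Binary.Reasoning.Setoid Poly.setoid
  X = xPowMinus1
  F = shiftedSum Φ r
  y = xPow (p * r)
  z = xPow ((q ∸ p) * r)
  a = ([ -[1+ 0 ] ] *P Φ) *P X (p * r)
  b = ([ + 0 ] *P Φ) *P X ((q ∸ p) * r)
  exponent : q * r ≡ p * r + (q ∸ p) * r
  exponent = trans (cong (_* r) (sym (ℕP.m+[n∸m]≡n p≤q))) (ℕP.*-distribʳ-+ r p (q ∸ p))
  last-block : (X r *P F (replicate p (+ 1) ++ [])) ≋ ((oneP *P Φ) *P X (p * r))
  last-block = Poly.trans (shiftedSum-replicate Φ r (+ 1) p [])
    (Poly.trans (Poly.+-congˡ {(oneP *P Φ) *P X (p * r)} (Poly.trans (Poly.*-congˡ {y} (Poly.zeroʳ (X r))) (Poly.zeroʳ y)))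
                (Poly.+-identityʳ ((oneP *P Φ) *P X (p * r))))

-- Unitary divisors of a product of three coprime prime powers

-- A common divisor of ab and c is coprime to a, because it divides c; hence it divides b.
coprime-*ˡ : ∀ {a b c} → Coprime a c → Coprime b c → Coprime (a * b) c
coprime-*ˡ a⊥c b⊥c (d∣ab , d∣c) =
  b⊥c (coprime-divisor (λ (e∣d , e∣a) → a⊥c (e∣a , ∣-trans e∣d d∣c)) d∣ab , d∣c)

prime∤⇒coprime-^ : ∀ {ℓ c} → Prime ℓ → ¬ ℓ ∣ c → ∀ k → Coprime (ℓ ^ k) c
prime∤⇒coprime-^ pr ℓ∤c zero    = 1-coprimeTo _
prime∤⇒coprime-^ {ℓ} {c} pr ℓ∤c (suc k) = coprime-*ˡ ℓ⊥c (prime∤⇒coprime-^ pr ℓ∤c k)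
  where
  ℓ⊥c : Coprime ℓ c
  ℓ⊥c (d∣ℓ , d∣c) with prime⇒irreducible pr d∣ℓ
  ... | inj₁ d≡1  = d≡1
  ... | inj₂ refl = contradiction d∣c ℓ∤c

prime∣prime⇒≡ : ∀ {x ℓ} → Prime x → Prime ℓ → x ∣ ℓ → x ≡ ℓ
prime∣prime⇒≡ px pℓ x∣ℓ with prime⇒irreducible pℓ x∣ℓ
... | inj₁ refl = contradiction px ¬prime[1]
... | inj₂ x≡ℓ  = x≡ℓ

prime∣^⇒≡ : ∀ {x ℓ} → Prime x → Prime ℓ → ∀ k → x ∣ ℓ ^ k → x ≡ ℓ
prime∣^⇒≡ px pℓ zero    x∣1 with refl ← ∣1⇒≡1 x∣1 = contradiction px ¬prime[1]
prime∣^⇒≡ {x} {ℓ} px pℓ (suc k) x∣ = [ prime∣prime⇒≡ px pℓ , prime∣^⇒≡ px pℓ k ]′ (euclidsLemma ℓ (ℓ ^ k) px x∣)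

primePower>1 : ∀ {p} → IsPrimePower p → 1 < p
primePower>1 (ℓ , k , pr , refl) = ℕP.<-≤-trans (ℕ.nonTrivial⇒n>1 ℓ {{prime⇒nonTrivial pr}})
  (ℕP.m≤m*n ℓ (ℓ ^ k) {{ℕP.m^n≢0 ℓ k {{prime⇒nonZero pr}}}})

primePower-nonZero : ∀ {p} → IsPrimePower p → NonZero p
primePower-nonZero pp = ℕ.>-nonZero (ℕP.<-trans ℕP.0<1+n (primePower>1 pp))

-- The base ℓ of p is the only prime dividing p, and coprimality keeps it from dividing m, so one
-- prime is added whatever the exponent.
ω-* : ∀ {m p} .{{_ : NonZero m}} → IsPrimePower p → Coprime m p → ω (m * p) ≡ suc (ω m)
ω-* {m} {p} (ℓ , k , pr , refl) m⊥p = ↭-length (unique-↭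
  (Unique.filter⁺ (isPrimeDivisor? (m * p)) (Unique.upTo⁺ (suc (m * p))))
  (All.tabulate (λ x∈ ℓ≡x → ℓ∤m (subst (_∣ m) (sym ℓ≡x) (proj₂ (proj₂ (primes⁻ m x∈)))))
    ∷ Unique.filter⁺ (isPrimeDivisor? m) (Unique.upTo⁺ (suc m)))
  sub sup)
  where
  instance
    _ : NonZero p
    _ = ℕP.m^n≢0 ℓ (suc k) {{prime⇒nonZero pr}}
    _ : NonZero (m * p)
    _ = ℕP.m*n≢0 m p
  isPrimeDivisor? : ∀ n → Decidable (λ x → Prime x × x ∣ n)
  isPrimeDivisor? n x = prime? x ×-dec (x ∣? n)
  primes : ℕ → List ℕ
  primes n = filter (isPrimeDivisor? n) (upTo (suc n))
  primes⁻ : ∀ n {x} → x ∈ primes n → x ∈ upTo (suc n) × Prime x × x ∣ n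
  primes⁻ n = ∈-filter⁻ (isPrimeDivisor? n) {xs = upTo (suc n)}
  primes⁺ : ∀ {n x} .{{_ : NonZero n}} → Prime x → x ∣ n → x ∈ primes n
  primes⁺ {n} px x∣n = ∈-filter⁺ (isPrimeDivisor? n) (∈-upTo⁺ (s≤s (∣⇒≤ x∣n))) (px , x∣n)
  ℓ∣p : ℓ ∣ p
  ℓ∣p = m∣m*n (ℓ ^ k)
  ℓ∤m : ¬ ℓ ∣ m
  ℓ∤m ℓ∣m = ¬prime[1] (subst Prime (m⊥p (ℓ∣m , ℓ∣p)) pr)
  sub : ∀ {x} → x ∈ primes (m * p) → x ∈ ℓ ∷ primes m
  sub {x} x∈ with _ , px , x∣mp ← primes⁻ (m * p) x∈ with euclidsLemma m p px x∣mp
  ... | inj₁ x∣m = there (primes⁺ px x∣m)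
  ... | inj₂ x∣p = here (prime∣^⇒≡ px pr (suc k) x∣p)
  sup : ∀ {x} → x ∈ ℓ ∷ primes m → x ∈ primes (m * p)
  sup (here refl) = primes⁺ pr (∣n⇒∣m*n m ℓ∣p)
  sup (there x∈) with _ , px , x∣m ← primes⁻ m x∈ = primes⁺ px (∣m⇒∣m*n p x∣m)

-- Splitting off one prime power

unitary-divides : ∀ {ℓ} k {d e m} → Prime ℓ → ¬ ℓ ∣ e → d * e ≡ m * ℓ ^ suc k → Coprime d e →
  ∃ λ d′ → d ≡ d′ * ℓ ^ suc k × d′ * e ≡ m × Coprime d′ e
unitary-divides {ℓ} k {d} {e} {m} pr ℓ∤e de≡mp d⊥e
  with divides d′ refl ← coprime-divisor {n = e} (prime∤⇒coprime-^ pr ℓ∤e (suc k)) (divides m (trans (ℕP.*-comm e d) de≡mp))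
  = d′ , refl , ℕP.*-cancelʳ-≡ (d′ * e) m (ℓ ^ suc k) (trans (swap-factors d′ e (ℓ ^ suc k)) de≡mp)
  , λ (x∣d′ , x∣e) → d⊥e (∣m⇒∣m*n (ℓ ^ suc k) x∣d′ , x∣e)
  where
  instance
    _ : NonZero (ℓ ^ suc k)
    _ = ℕP.m^n≢0 ℓ (suc k) {{prime⇒nonZero pr}}
  swap-factors : ∀ x y z → x * y * z ≡ x * z * y
  swap-factors = solve-∀

-- One Boolean per prime power records which of two complementary divisors receives it; the other
-- divisor uses the negated Boolean.
pick : Bool → ℕ → ℕ
pick true  p = p
pick false p = 1

-- The base ℓ cannot divide both d and e. The one that it does not divide is coprime to the whole
-- power p, so all of p divides the other.
unitary-split : ∀ {p d e m} → IsPrimePower p → d * e ≡ m * p → Coprime d e →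
  ∃ λ c → ∃ λ d′ → ∃ λ e′ → d ≡ d′ * pick c p × e ≡ e′ * pick (not c) p × d′ * e′ ≡ m × Coprime d′ e′
unitary-split {d = d} {e} (ℓ , k , pr , refl) de≡mp d⊥e with ℓ ∣? e
... | no  ℓ∤e with d′ , d≡ , d′e≡m , d′⊥e ← unitary-divides k pr ℓ∤e de≡mp d⊥e =
  true , d′ , e , d≡ , sym (ℕP.*-identityʳ e) , d′e≡m , d′⊥e
... | yes ℓ∣e with e′ , e≡ , e′d≡m , e′⊥d ← unitary-divides k pr
    (λ ℓ∣d → ¬prime[1] (subst Prime (d⊥e (ℓ∣d , ℓ∣e)) pr)) (trans (ℕP.*-comm e d) de≡mp) (Coprimality.sym d⊥e) =
  false , d , e′ , sym (ℕP.*-identityʳ d) , e≡ , trans (ℕP.*-comm d e′) e′d≡m , Coprimality.sym e′⊥d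

pick-* : ∀ c {p d e m} → d * e ≡ m → (d * pick c p) * (e * pick (not c) p) ≡ m * p
pick-* true  {p} {d} {e} refl = rearrange d e p
  where
  rearrange : ∀ d e p → d * p * (e * 1) ≡ d * e * p
  rearrange = solve-∀
pick-* false {p} {d} {e} refl = rearrange d e p
  where
  rearrange : ∀ d e p → d * 1 * (e * p) ≡ d * e * p
  rearrange = solve-∀

coprime-pick : ∀ c {d p q} → Coprime d q → Coprime p q → Coprime (d * pick c p) q
coprime-pick true  d⊥q p⊥q = coprime-*ˡ d⊥q p⊥q
coprime-pick false d⊥q p⊥q = coprime-*ˡ d⊥q (1-coprimeTo _)

coprime-complement : ∀ c {d e p} → Coprime d e → Coprime d p → Coprime e p →
  Coprime (d * pick c p) (e * pick (not c) p)
coprime-complement true {d} {e} d⊥e d⊥p e⊥p =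
  coprime-*ˡ (subst (Coprime d) (sym (ℕP.*-identityʳ e)) d⊥e) (subst (Coprime _) (sym (ℕP.*-identityʳ e)) (Coprimality.sym e⊥p))
coprime-complement false {d} {e} d⊥e d⊥p e⊥p = Coprimality.sym
  (coprime-*ˡ (subst (Coprime e) (sym (ℕP.*-identityʳ d)) (Coprimality.sym d⊥e)) (subst (Coprime _) (sym (ℕP.*-identityʳ d)) (Coprimality.sym d⊥p)))

bit : Bool → ℕ
bit true  = 1
bit false = 0

ω-pick : ∀ c m {p} .{{_ : NonZero m}} → IsPrimePower p → Coprime m p → ω (m * pick c p) ≡ bit c + ω m
ω-pick true  m pp m⊥p = ω-* pp m⊥p
ω-pick false m pp m⊥p = cong ω (ℕP.*-identityʳ m)

pick-nonZero : ∀ c m {p} .{{_ : NonZero m}} → IsPrimePower p → NonZero (m * pick c p)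
pick-nonZero true  m {p} pp = ℕP.m*n≢0 m p {{it}} {{primePower-nonZero pp}}
pick-nonZero false m pp = ℕP.m*n≢0 m 1

-- The list of unitary divisors whose cofactor satisfies R

module _ {n} .{{_ : NonZero n}} {R : Pred ℕ 0ℓ} (R? : Decidable R) where

  private
    unitary? = isUnitaryDivisor? n
    R/? = λ d → R? (n / suc d)

  unitaryIndices : List ℕ
  unitaryIndices = filter R/? (filter unitary? (upTo n))

  -- Undoes the index shift of `IsUnitaryDivisor`. With R as a parameter, both parities of `ω` are
  -- treated at once.
  unitaryDivisors : List ℕ
  unitaryDivisors = map suc unitaryIndices

  ∈-unitaryDivisors⁻ : ∀ {x} → x ∈ unitaryDivisors → ∃ λ e → x * e ≡ n × Coprime x e × R e
  ∈-unitaryDivisors⁻ x∈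
    with d , d∈ , refl ← ∈-map⁻ suc x∈
    with d∈′ , Re ← ∈-filter⁻ R/? {xs = filter unitary? (upTo n)} d∈
    with _ , d∣n , gcd≡1 ← ∈-filter⁻ unitary? {xs = upTo n} d∈′
    = n / suc d , m*[n/m]≡n d∣n , gcd≡1⇒coprime gcd≡1 , Re

  ∈-unitaryDivisors⁺ : ∀ {x e} → x * e ≡ n → Coprime x e → R e → x ∈ unitaryDivisors
  ∈-unitaryDivisors⁺ {zero} refl _ _ = contradiction refl (ℕ.≢-nonZero⁻¹ 0)
  ∈-unitaryDivisors⁺ {suc d} {e} xe≡n x⊥e Re = ∈-map⁺ suc (∈-filter⁺ R/?
    (∈-filter⁺ unitary? (∈-upTo⁺ (∣⇒≤ d∣n)) (d∣n , coprime⇒gcd≡1 (subst (Coprime (suc d)) (sym quotient≡) x⊥e)))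
    (subst R (sym quotient≡) Re))
    where
    d∣n : suc d ∣ n
    d∣n = divides e (trans (sym xe≡n) (ℕP.*-comm (suc d) e))
    quotient≡ : n / suc d ≡ e
    quotient≡ = n/m≡quotient d∣n

  unitaryDivisors-unique : Unique unitaryDivisors
  unitaryDivisors-unique = Unique.map⁺ ℕP.suc-injective (Unique.filter⁺ R/? (Unique.filter⁺ unitary? (Unique.upTo⁺ n)))

-- For the chains p < q < r < pqr and 1 < pq < pr < qr.
<-sorted⇒unique : ∀ {xs} → Linked _<_ xs → Unique xs
<-sorted⇒unique l = AllPairs.map ℕP.<⇒≢ (Linked⇒AllPairs ℕP.<-trans l)

module Threefold {p q r} (pp : IsPrimePower p) (qq : IsPrimePower q) (rr : IsPrimePower r)
  (p⊥q : Coprime p q) (p⊥r : Coprime p r) (q⊥r : Coprime q r) where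

  -- The leading 1 is what remains of a divisor once r, q and p have been split off in turn; keeping
  -- it lets `unitary⇒divisor` end in `refl`.
  divisor : Bool → Bool → Bool → ℕ
  divisor a b c = 1 * pick a p * pick b q * pick c r

  unitary⇒divisor : ∀ {d e} → d * e ≡ p * q * r → Coprime d e →
    ∃ λ a → ∃ λ b → ∃ λ c → d ≡ divisor a b c × e ≡ divisor (not a) (not b) (not c)
  unitary⇒divisor de≡ d⊥e
    with c , d₁ , e₁ , refl , refl , de₁≡ , d₁⊥e₁ ← unitary-split {m = p * q} rr de≡ d⊥e
    with b , d₂ , e₂ , refl , refl , de₂≡ , d₂⊥e₂ ← unitary-split {m = p} qq de₁≡ d₁⊥e₁
    with a , d₃ , e₃ , refl , refl , de₃≡ , d₃⊥e₃ ← unitary-split {m = 1} pp (trans de₂≡ (sym (ℕP.*-identityˡ p))) d₂⊥e₂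
    with refl ← ℕP.m*n≡1⇒m≡1 d₃ e₃ de₃≡ | refl ← ℕP.m*n≡1⇒n≡1 d₃ e₃ de₃≡
    = a , b , c , refl , refl

  pick-⊥q : ∀ a → Coprime (1 * pick a p) q
  pick-⊥q a = coprime-pick a (1-coprimeTo q) p⊥q

  pick-⊥r : ∀ a b → Coprime (1 * pick a p * pick b q) r
  pick-⊥r a b = coprime-pick b (coprime-pick a (1-coprimeTo r) p⊥r) q⊥r

  divisor-* : ∀ a b c → divisor a b c * divisor (not a) (not b) (not c) ≡ p * q * r
  divisor-* a b c = pick-* c {d = 1 * pick a p * pick b q} {e = 1 * pick (not a) p * pick (not b) q}
    (pick-* b {d = 1 * pick a p} {e = 1 * pick (not a) p} (trans (pick-* a {d = 1} {e = 1} {m = 1} refl) (ℕP.*-identityˡ p)))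

  divisor-⊥ : ∀ a b c → Coprime (divisor a b c) (divisor (not a) (not b) (not c))
  divisor-⊥ a b c = coprime-complement c
    (coprime-complement b (coprime-complement a (1-coprimeTo 1) (1-coprimeTo p) (1-coprimeTo p)) (pick-⊥q a) (pick-⊥q (not a)))
    (pick-⊥r a b) (pick-⊥r (not a) (not b))

  -- The final 0 is `ω 1`, by computation.
  ω-divisor : ∀ a b c → ω (divisor a b c) ≡ bit c + (bit b + (bit a + 0))
  ω-divisor a b c = trans (ω-pick c (1 * pick a p * pick b q) rr (pick-⊥r a b)) (cong (ℕ._+_ (bit c))
    (trans (ω-pick b (1 * pick a p) qq (pick-⊥q a)) (cong (ℕ._+_ (bit b)) (ω-pick a 1 pp (1-coprimeTo p)))))
    where
    instance
      _ : NonZero (1 * pick a p)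
      _ = pick-nonZero a 1 pp
      _ : NonZero (1 * pick a p * pick b q)
      _ = pick-nonZero b (1 * pick a p) qq

-- Numerator, denominator and the defining equation

module Factors {p q r} (pp : IsPrimePower p) (qq : IsPrimePower q) (rr : IsPrimePower r)
  (p⊥q : Coprime p q) (p⊥r : Coprime p r) (q⊥r : Coprime q r) (p<q : p < q) (q<r : q < r)
  .{{_ : NonZero (p * q * r)}} where

  open Threefold pp qq rr p⊥q p⊥r q⊥r

  instance
    p≢0 : NonZero p
    p≢0 = primePower-nonZero pp
    q≢0 : NonZero q
    q≢0 = primePower-nonZero qq
    r≢0 : NonZero r
    r≢0 = primePower-nonZero rr

  p<pq : p < p * q
  p<pq = ℕP.m<m*n p q (primePower>1 qq)

  1<pq : 1 < p * q
  1<pq = ℕP.<-trans (primePower>1 pp) p<pq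

  r<pqr : r < p * q * r
  r<pqr = subst (r <_) (ℕP.*-comm r (p * q)) (ℕP.m<m*n r (p * q) 1<pq)

  divisor-complement∈ : ∀ {R : Pred ℕ _} (R? : Decidable R) a b c → R (divisor (not a) (not b) (not c)) →
    divisor a b c ∈ unitaryDivisors R?
  divisor-complement∈ R? a b c = ∈-unitaryDivisors⁺ R? (divisor-* a b c) (divisor-⊥ a b c)

  -- The cofactors of p, q and r have two primes each, and that of pqr has none.
  positive-↭ : unitaryDivisors {p * q * r} μ*Positive? ↭ p ∷ q ∷ r ∷ p * q * r ∷ []
  positive-↭ = subst (unitaryDivisors μ*Positive? ↭_) simplify (unique-↭ (unitaryDivisors-unique μ*Positive?)
    (subst Unique (sym simplify) (<-sorted⇒unique (p<q ∷ q<r ∷ r<pqr ∷ [-]))) sub sup)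
    where
    ds = divisor true false false ∷ divisor false true false ∷ divisor false false true ∷ divisor true true true ∷ []
    simplify : ds ≡ p ∷ q ∷ r ∷ p * q * r ∷ []
    simplify = cong₂ _∷_ (e₁ p) (cong₂ _∷_ (e₂ q) (cong₂ _∷_ (e₃ r) (cong₂ _∷_ (e₄ p q r) refl)))
      where
      e₁ : ∀ p → 1 * p * 1 * 1 ≡ p
      e₁ = solve-∀
      e₂ : ∀ q → 1 * 1 * q * 1 ≡ q
      e₂ = solve-∀
      e₃ : ∀ r → 1 * 1 * 1 * r ≡ r
      e₃ = solve-∀
      e₄ : ∀ p q r → 1 * p * q * r ≡ p * q * r
      e₄ = solve-∀
    case : ∀ a b c → (bit (not c) + (bit (not b) + (bit (not a) + 0))) % 2 ≡ 0 → divisor a b c ∈ ds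
    -- For the four patterns left out, the parity hypothesis computes to 1 ≡ 0, which is absurd.
    case true  false false _ = here refl
    case false true  false _ = there (here refl)
    case false false true  _ = there (there (here refl))
    case true  true  true  _ = there (there (there (here refl)))
    sub : ∀ {x} → x ∈ unitaryDivisors μ*Positive? → x ∈ ds
    sub x∈ with e , xe≡n , x⊥e , even ← ∈-unitaryDivisors⁻ μ*Positive? x∈
      with a , b , c , refl , refl ← unitary⇒divisor xe≡n x⊥e
      = case a b c (trans (cong (_% 2) (sym (ω-divisor (not a) (not b) (not c)))) even)
    sup : ∀ {x} → x ∈ ds → x ∈ unitaryDivisors μ*Positive?
    sup (here refl)                         = divisor-complement∈ μ*Positive? true  false false (cong (_% 2) (ω-divisor false true  true ))
    sup (there (here refl))                 = divisor-complement∈ μ*Positive? false true  false (cong (_% 2) (ω-divisor true  false true ))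
    sup (there (there (here refl)))         = divisor-complement∈ μ*Positive? false false true  (cong (_% 2) (ω-divisor true  true  false))
    sup (there (there (there (here refl)))) = divisor-complement∈ μ*Positive? true  true  true  (cong (_% 2) (ω-divisor false false false))

  -- The cofactor of 1 has three primes, and those of pq, pr and qr have one each.
  negative-↭ : unitaryDivisors {p * q * r} μ*Negative? ↭ 1 ∷ p * q ∷ p * r ∷ q * r ∷ []
  negative-↭ = subst (unitaryDivisors μ*Negative? ↭_) simplify (unique-↭ (unitaryDivisors-unique μ*Negative?)
    (subst Unique (sym simplify) (<-sorted⇒unique (1<pq ∷ ℕP.*-monoʳ-< p q<r ∷ ℕP.*-monoˡ-< r p<q ∷ [-]))) sub sup)
    where
    ds = divisor false false false ∷ divisor true true false ∷ divisor true false true ∷ divisor false true true ∷ []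
    simplify : ds ≡ 1 ∷ p * q ∷ p * r ∷ q * r ∷ []
    simplify = cong₂ _∷_ refl (cong₂ _∷_ (e₂ p q) (cong₂ _∷_ (e₃ p r) (cong₂ _∷_ (e₄ q r) refl)))
      where
      e₂ : ∀ p q → 1 * p * q * 1 ≡ p * q
      e₂ = solve-∀
      e₃ : ∀ p r → 1 * p * 1 * r ≡ p * r
      e₃ = solve-∀
      e₄ : ∀ q r → 1 * 1 * q * r ≡ q * r
      e₄ = solve-∀
    case : ∀ a b c → (bit (not c) + (bit (not b) + (bit (not a) + 0))) % 2 ≡ 1 → divisor a b c ∈ ds
    case false false false _ = here refl
    case true  true  false _ = there (here refl)
    case true  false true  _ = there (there (here refl))
    case false true  true  _ = there (there (there (here refl)))
    sub : ∀ {x} → x ∈ unitaryDivisors μ*Negative? → x ∈ ds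
    sub x∈ with e , xe≡n , x⊥e , odd ← ∈-unitaryDivisors⁻ μ*Negative? x∈
      with a , b , c , refl , refl ← unitary⇒divisor xe≡n x⊥e
      = case a b c (trans (cong (_% 2) (sym (ω-divisor (not a) (not b) (not c)))) odd)
    sup : ∀ {x} → x ∈ ds → x ∈ unitaryDivisors μ*Negative?
    sup (here refl)                         = divisor-complement∈ μ*Negative? false false false (cong (_% 2) (ω-divisor true  true  true ))
    sup (there (here refl))                 = divisor-complement∈ μ*Negative? true  true  false (cong (_% 2) (ω-divisor false false true ))
    sup (there (there (here refl)))         = divisor-complement∈ μ*Negative? true  false true  (cong (_% 2) (ω-divisor false true  false))
    sup (there (there (there (here refl)))) = divisor-complement∈ μ*Negative? false true  true  (cong (_% 2) (ω-divisor true  false false))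

  ΦNum≋ : ΦNum (p * q * r) ≋ prodP (map xPowMinus1 (p ∷ q ∷ r ∷ p * q * r ∷ []))
  ΦNum≋ = Poly.trans (Poly.reflexive (cong prodP (map-∘ (unitaryIndices μ*Positive?))))
    (foldr-map-↭ Poly.*-commutativeMonoid xPowMinus1 positive-↭)

  ΦDen≋ : ΦDen (p * q * r) ≋ prodP (map xPowMinus1 (1 ∷ p * q ∷ p * r ∷ q * r ∷ []))
  ΦDen≋ = Poly.trans (Poly.reflexive (cong prodP (map-∘ (unitaryIndices μ*Negative?))))
    (foldr-map-↭ Poly.*-commutativeMonoid xPowMinus1 negative-↭)

  -- Since n is among the divisors in `ΦNum`, the factor x^n - 1 stands on both sides and is carried
  -- along; the rest combines the two given identities.
  isΨ* : ∀ Φ f → ((Φ *P xPowMinus1 p) *P xPowMinus1 q) ≋ (xPowMinus1 (p * q) *P xPowMinus1 1) →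
    (xPowMinus1 r *P f) ≋ (Φ *P (xPowMinus1 (p * r) *P xPowMinus1 (q * r))) → IsΨ* (p * q * r) f
  isΨ* Φ f Φ-identity f-identity = coeffs (begin
    f *P ΦNum n
      ≈⟨ Poly.*-congˡ {f} ΦNum≋ ⟩
    f *P (X p *P (X q *P (X r *P (X n *P oneP))))
      ≈⟨ solve 5 (λ f p q r n → f :* (p :* (q :* (r :* (n :* con (+ 1))))) := ((r :* f) :* (p :* q)) :* n)
               Poly.refl f (X p) (X q) (X r) (X n) ⟩
    ((X r *P f) *P (X p *P X q)) *P X n
      ≈⟨ Poly.*-congʳ {X n} (Poly.*-congʳ {X p *P X q} f-identity) ⟩
    ((Φ *P (X (p * r) *P X (q * r))) *P (X p *P X q)) *P X n
      ≈⟨ solve 6 (λ φ pr qr p q n → ((φ :* (pr :* qr)) :* (p :* q)) :* n := ((φ :* p) :* q) :* ((pr :* qr) :* n))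
               Poly.refl Φ (X (p * r)) (X (q * r)) (X p) (X q) (X n) ⟩
    ((Φ *P X p) *P X q) *P ((X (p * r) *P X (q * r)) *P X n)
      ≈⟨ Poly.*-congʳ {(X (p * r) *P X (q * r)) *P X n} Φ-identity ⟩
    (X (p * q) *P X 1) *P ((X (p * r) *P X (q * r)) *P X n)
      ≈⟨ solve 5 (λ pq x pr qr n → (pq :* x) :* ((pr :* qr) :* n) := n :* (x :* (pq :* (pr :* (qr :* con (+ 1))))))
               Poly.refl (X (p * q)) (X 1) (X (p * r)) (X (q * r)) (X n) ⟩
    X n *P (X 1 *P (X (p * q) *P (X (p * r) *P (X (q * r) *P oneP))))
      ≈⟨ Poly.*-congˡ {X n} ΦDen≋ ⟨
    X n *P ΦDen n ∎)
    where
    open PolySolver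
    open import Relation.Binary.Reasoning.Setoid Poly.setoid
    X = xPowMinus1
    n = p * q * r

-- From q - 1 < r and p - 1 > 0 comes (p - 1)(q - 1) < (p - 1)r, so the quotient is strictly below p
-- - 1, which leaves room for the added 1.
[p-1][q-1]/r<p-1 : ∀ {p q} r .{{_ : NonZero r}} → 1 < p → q < r → ((p ∸ 1) * (q ∸ 1)) / r + 1 ≤ p ∸ 1
[p-1][q-1]/r<p-1 {suc p} {q} r (s≤s 0<p) q<r = subst (_≤ p) (ℕP.+-comm 1 _)
  (m<n*o⇒m/o<n (ℕP.*-monoʳ-< p {{ℕ.>-nonZero 0<p}} (ℕP.≤-<-trans (ℕP.m∸n≤m q 1) q<r)))

theorem11 : (p q r : ℕ) → IsPrimePower p → IsPrimePower q → IsPrimePower r →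
    Coprime p q → Coprime p r → Coprime q r → p < q → q < r →
    ⦃ _ : NonZero r ⦄ → ⦃ _ : NonZero (p * q * r) ⦄ →
    Σ Poly (λ f → IsΨ* (p * q * r) f ×
    (H f ≤ ((p ∸ 1) * (q ∸ 1)) / r + 1) ×
    (((p ∸ 1) * (q ∸ 1)) / r + 1 ≤ p ∸ 1))
theorem11 p q r pp qq rr p⊥q p⊥r q⊥r p<q q<r
  with Φ , Φ-identity , Φ≤1 , Φ-degree ←
         binary-cyclotomic p q {{primePower-nonZero pp}} {{primePower-nonZero qq}} p⊥q
  = let f = shiftedSum Φ r (inverseCoeffs p q) in
    f
  , Factors.isΨ* pp qq rr p⊥q p⊥r q⊥r p<q q<r Φ f Φ-identity
      (shiftedSum-inverseCoeffs Φ p q r (ℕP.<⇒≤ p<q))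
  , H-bound f (shiftedSum-coeff≤ Φ r Φ≤1 Φ-degree (inverseCoeffs p q) (inverseCoeffs≤1 p q))
  , [p-1][q-1]/r<p-1 r (primePower>1 pp) q<r
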